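{- Let $(I,\preceq)$ be a finite poset; for each $i\in I$ let $X_i$ be a finite set with $|X_i|\ge2$ and $P_i$ a Markov chain on $X_i$, and let $\mathbb{L}_i$ be the set of all partitions of $X_i$ with respect to which $P_i$ is lumpable. Let $\{p_i^0\}_{i\in I}$ be a strict probability measure on $I$ and $\mathcal{P}$ the generalized crested product of the $P_i$ defined by $(I,\preceq)$ and $\{p_i^0\}$. For each $i\in I$ let $\Phi_i:X_{A(i)}\to\mathbb{L}_i$ be a map (when $A(i)=\emptyset$, $X_{A(i)}$ is a one-point set and $\Phi_i$ is a single choice of a partition in $\mathbb L_i$), such that $\Phi_i(x_{A(i)})=\Phi_i(y_{A(i)})$ whenever, for every $j\in A(i)$, $\Phi_j(x_{A(j)})=\Phi_j(y_{A(j)})$ and $x_j,y_j$ lie in the same part of this partition. Let $\mathcal{L}$ be the partition of $X=\prod_{i\in I}X_i$ (the generalized product of lumpings) into the classes of the relation: $x\approx y$ iff for every $i\in I$, $\Phi_i(x_{A(i)})=\Phi_i(y_{A(i)})$ and $x_i,y_i$ lie in the same part of this partition of $X_i$. Then $\mathcal{P}$ is lumpable with respect to $\mathcal{L}$.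
   Context: $A(i)=\{j\in I: j\succ i\}$, $H(i)=\{j\in I:j\prec i\}$, $H[i]=H(i)\sqcup\{i\}$; for $J\subseteq I$, $X_J=\prod_{j\in J}X_j$ and $x_J$ is the projection of $x$ onto $X_J$. The generalized crested product is the chain on $X$ with $p(x,y)=\sum_{i\in I}p_i^0\,p_i(x_i,y_i)\prod_{j\in H(i)}\frac{1}{|X_j|}\prod_{j\notin H[i]}\delta(x_j,y_j)$ ($\delta$ the Kronecker delta, $p_i^0>0$, $\sum_ip_i^0=1$). A chain $p$ is lumpable with respect to a partition if for all parts $L,L'$ the map $x\mapsto\sum_{y\in L'}p(x,y)$ is constant on $L$. -}

module Defs where

open import Algebra.Apartness.Bundles using (HeytingField)
open import Algebra.Bundles using (CommutativeRing; Semiring)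
import Algebra.Definitions.RawSemiring
open import Data.Fin.Base using (Fin; zero; suc)
open import Data.Fin.Properties using (_≟_; all?; ∀-cons)
open import Data.List.Base using (List; []; _∷_; allFin; cartesianProductWith; filter; foldr; map)
open import Data.Nat.Base as ℕ using (ℕ; zero; suc; NonZero; >-nonZero)
open import Data.Nat.Properties using (≤-trans; n≤1+n)
open import Data.Product.Base using (Σ; _×_; _,_; proj₁; proj₂; uncurry; <_,_>)
open import Data.Sum.Base using (_⊎_; inj₂)
open import Function.Base using (_∘_)
open import Function.Bundles using (_⇔_; mk⇔; Equivalence)
open import Function.Construct.Identity using (⇔-id)
open import Function.Construct.Symmetry using (⇔-sym)
open import Function.Construct.Composition using (_⇔-∘_)
open import Level using (0ℓ; _⊔_) renaming (suc to lsuc)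
open import Data.Bool.Base using (if_then_else_)
open import Relation.Binary.Core using (Rel)
open import Relation.Binary.Definitions using (Decidable)
open import Relation.Binary.PropositionalEquality.Core using (_≡_)
open import Relation.Binary.Structures using (IsDecEquivalence; IsDecPartialOrder; IsStrictPartialOrder)
import Relation.Binary.Construct.NonStrictToStrict as Strict
open import Relation.Nullary using (¬_; does)
open import Relation.Nullary.Decidable using (¬?; map′; _×-dec_; _→-dec_; _⊎-dec_)
open import Relation.Unary using (Pred; _∈_)
import Relation.Unary as Unary

-- The scalars.  Since no completeness is assumed, classical ℝ, the constructive
-- reals and ℚ are all models; order and equality need not be decidable.
record OrderedField c ℓ₁ ℓ₂ : Set (lsuc (c ⊔ ℓ₁ ⊔ ℓ₂)) where
  infix 4 _<_ _≤_
  field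
    heytingField : HeytingField c ℓ₁ ℓ₂

  open HeytingField heytingField public

  field
    _<_                  : Rel Carrier ℓ₂
    isStrictPartialOrder : IsStrictPartialOrder _≈_ _<_
    #⇔<⊎>                : ∀ {x y} → (x # y) ⇔ (x < y ⊎ y < x)
    0<1                  : 0# < 1#
    +-monoʳ-<            : ∀ z {x y} → x < y → z + x < z + y
    *-pos                : ∀ {x y} → 0# < x → 0# < y → 0# < x * y

  _≤_ : Rel Carrier ℓ₂
  x ≤ y = ¬ (y < x)

  module < = IsStrictPartialOrder isStrictPartialOrder

  commutativeRing : CommutativeRing c ℓ₁
  commutativeRing = record { isCommutativeRing = isCommutativeRing }

  open Algebra.Definitions.RawSemiring (Semiring.rawSemiring (CommutativeRing.semiring commutativeRing))
    public using () renaming (_×_ to _·_)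

  0<1+n : ∀ n → 0# < suc n · 1#
  0<1+n zero    = <.<-respʳ-≈ (sym (+-identityʳ 1#)) 0<1
  0<1+n (suc n) =
    <.trans 0<1 (<.<-respˡ-≈ (+-identityʳ 1#) (+-monoʳ-< 1# (0<1+n n)))

  -- `#⇒invertible` inverts the difference  n · 1# - 0#.
  recip : (n : ℕ) .{{_ : NonZero n}} → Carrier
  recip (suc n) = proj₁ (#⇒invertible (Equivalence.from #⇔<⊎> (inj₂ (0<1+n n))))

  ∑ ∏ : ∀ {a} {A : Set a} → List A → (A → Carrier) → Carrier
  ∑ xs f = foldr _+_ 0# (map f xs)
  ∏ xs f = foldr _*_ 1# (map f xs)

  δ : ∀ {n} → Fin n → Fin n → Carrier
  δ u v = if does (u ≟ v) then 1# else 0#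

-- A partition is given by the relation "lies in the same part".
record Partition (A : Set) : Set₁ where
  infix 4 _~_
  field
    _~_              : Rel A 0ℓ
    isDecEquivalence : IsDecEquivalence _~_

  open IsDecEquivalence isDecEquivalence public using (refl; sym; trans)
    renaming (_≟_ to _~?_)

  -- Every part is nonempty, hence the part of one of its elements.
  part : A → Pred A 0ℓ
  part z x = z ~ x

  part? : ∀ z → Unary.Decidable (part z)
  part? z x = z ~? x

open Partition public using (part; part?)

infix 4 _~[_]_ _≋_ _≋?_

_~[_]_ : ∀ {A} → A → Partition A → A → Set
x ~[ 𝓟 ] y = Partition._~_ 𝓟 x y

_≋_ : ∀ {A} → Rel (Partition A) 0ℓ
𝓟 ≋ 𝓠 = ∀ x y → (x ~[ 𝓟 ] y) ⇔ (x ~[ 𝓠 ] y)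

_≋?_ : ∀ {n} → Decidable (_≋_ {Fin n})
𝓟 ≋? 𝓠 = all? λ x → all? λ y →
  let p = Partition._~?_ 𝓟 x y
      q = Partition._~?_ 𝓠 x y
  in map′ (uncurry mk⇔) < Equivalence.to , Equivalence.from >
       ((p →-dec q) ×-dec (q →-dec p))

module _ {n : ℕ} (size : Fin n → ℕ) where

  Point : Set
  Point = (i : Fin n) → Fin (size i)

  -- X_J.  The membership proof is irrelevant, so that a coordinate depends on j only.
  X⟨_⟩ : Pred (Fin n) 0ℓ → Set
  X⟨ J ⟩ = (j : Fin n) → .(j ∈ J) → Fin (size j)

-- Every point occurs exactly once, up to pointwise equality.
points : ∀ {n} (size : Fin n → ℕ) → List (Point size)
points {zero}  size = (λ ()) ∷ []
points {suc n} size =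
  cartesianProductWith (∀-cons {P = Fin ∘ size}) (allFin (size zero)) (points (size ∘ suc))

restrict : ∀ {n} {size : Fin n → ℕ} (J : Pred (Fin n) 0ℓ) → Point size → X⟨_⟩ size J
restrict J x j _ = x j

module FinitePoset {n : ℕ} {_⪯_ : Rel (Fin n) 0ℓ} (isPoset : IsDecPartialOrder _≡_ _⪯_) where

  infix 4 _≺_ _≺?_

  _≺_ : Rel (Fin n) 0ℓ
  _≺_ = Strict._<_ _≡_ _⪯_

  _≺?_ : Decidable _≺_
  _≺?_ = Strict.<-decidable _≡_ _⪯_ _≟_ (IsDecPartialOrder._≤?_ isPoset)

  A H H[_] : Fin n → Pred (Fin n) 0ℓ
  A i j    = i ≺ j
  H i j    = j ≺ i
  H[ i ] j = j ∈ H i ⊎ j ≡ i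

  H? : ∀ i → Unary.Decidable (H i)
  H? i j = j ≺? i

  H[_]? : ∀ i → Unary.Decidable H[ i ]
  H[ i ]? j = H? i j ⊎-dec (j ≟ i)

module Chains {c ℓ₁ ℓ₂} (𝔽 : OrderedField c ℓ₁ ℓ₂) where

  open OrderedField 𝔽

  Kernel : Set → Set c
  Kernel A = A → A → Carrier

  record MarkovChain (m : ℕ) : Set (c ⊔ ℓ₁ ⊔ ℓ₂) where
    field
      kernel      : Kernel (Fin m)
      nonnegative : ∀ u v → 0# ≤ kernel u v
      row-sum     : ∀ u → ∑ (allFin m) (kernel u) ≈ 1#

  open MarkovChain public using (kernel)

  record StrictProbability (n : ℕ) : Set (c ⊔ ℓ₁ ⊔ ℓ₂) where
    field
      weight   : Fin n → Carrier
      positive : ∀ i → 0# < weight i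
      total    : ∑ (allFin n) weight ≈ 1#

  open StrictProbability public using (weight)

  -- The list enumerates the state space A.
  Lumpable : ∀ {A} → List A → Kernel A → Partition A → Set ℓ₁
  Lumpable states p 𝓟 = ∀ z z′ x x′ → x ∈ part 𝓟 z → x′ ∈ part 𝓟 z →
    let L′ = filter (part? 𝓟 z′) states in
    ∑ L′ (p x) ≈ ∑ L′ (p x′)

  𝕃 : ∀ {m} → MarkovChain m → Set (lsuc 0ℓ ⊔ ℓ₁)
  𝕃 {m} P = Σ (Partition (Fin m)) (Lumpable (allFin m) (kernel P))

module CrestedProduct
  {c ℓ₁ ℓ₂} (𝔽 : OrderedField c ℓ₁ ℓ₂)
  {n : ℕ} {_⪯_ : Rel (Fin n) 0ℓ} (isPoset : IsDecPartialOrder _≡_ _⪯_)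
  (size : Fin n → ℕ) (2≤size : ∀ i → 2 ℕ.≤ size i)
  (P : ∀ i → Chains.MarkovChain 𝔽 (size i))
  where

  open OrderedField 𝔽
  open Chains 𝔽
  open FinitePoset isPoset public

  1/∣X∣ : Fin n → Carrier
  1/∣X∣ j = recip (size j) {{>-nonZero (≤-trans (n≤1+n 1) (2≤size j))}}

  crestedProduct : StrictProbability n → Kernel (Point size)
  crestedProduct p⁰ x y = ∑ (allFin n) λ i →
      weight p⁰ i
    * kernel (P i) (x i) (y i)
    * ∏ (filter (H? i) (allFin n)) 1/∣X∣
    * ∏ (filter (¬? ∘ H[ i ]?) (allFin n)) (λ j → δ (x j) (y j))

  module Lumpings (Φ : ∀ i → X⟨_⟩ size (A i) → 𝕃 (P i)) where

    Φ⟨_⟩ : ∀ i → Point size → Partition (Fin (size i))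
    Φ⟨ i ⟩ x = proj₁ (Φ i (restrict (A i) x))

    Agree : Fin n → Rel (Point size) 0ℓ
    Agree i x y = Φ⟨ i ⟩ x ≋ Φ⟨ i ⟩ y × x i ~[ Φ⟨ i ⟩ x ] y i

    Compatible : Set
    Compatible = ∀ i x y → (∀ j → j ∈ A i → Agree j x y) → Φ⟨ i ⟩ x ≋ Φ⟨ i ⟩ y

    productOfLumpings : Partition (Point size)
    productOfLumpings = record
      { _~_ = λ x y → ∀ i → Agree i x y
      ; isDecEquivalence = record
        { isEquivalence = record
          { refl  = λ {x} i → (λ _ _ → ⇔-id _) , Partition.refl (Φ⟨ i ⟩ x)
          ; sym   = λ {x} {y} x≈y i → let (eq , r) = x≈y i in
              (λ u v → ⇔-sym (eq u v)) ,
              Equivalence.to (eq (y i) (x i)) (Partition.sym (Φ⟨ i ⟩ x) r)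
          ; trans = λ {x} {y} {z} x≈y y≈z i →
              let (eq , r) = x≈y i ; (eq′ , r′) = y≈z i in
              (λ u v → eq′ u v ⇔-∘ eq u v) ,
              Partition.trans (Φ⟨ i ⟩ x) r (Equivalence.from (eq (y i) (z i)) r′)
          }
        ; _≟_ = λ x y → all? λ i →
            (Φ⟨ i ⟩ x ≋? Φ⟨ i ⟩ y) ×-dec Partition._~?_ (Φ⟨ i ⟩ x) (x i) (y i)
        }
      }

{-# OPTIONS --safe #-}

-- A compatible family Φ makes every class of 𝓛 a product: y lies in the class of z
-- iff y_j lies in the part of z_j for the partition Φ_j(z) chosen at z, for every j
-- (induct downwards from the maximal elements of I).  The i-th summand of the
-- transition probability is a product over coordinates too, so its sum over the class
-- of z factors as a product of one-coordinate sums.  Now let x ≈ x′.  If x_j is in the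
-- part of z_j for all j outside H[i], then so is x′_j, and the factors for x and x′
-- agree: outside H[i] the identity chain is lumpable for every partition, at i one
-- uses the lumpability of P_i for Φ_i(x) = Φ_i(z), and the factors below i are
-- constant.  Otherwise, for x and x′ alike, some identity factor outside H[i] vanishes.
module Submission where

open import Defs
open import Algebra.Bundles using (CommutativeMonoid; CommutativeSemiring; CommutativeRing)
import Algebra.Properties.CommutativeSemigroup as CommutativeSemigroupProperties
open import Data.Bool.Base using (if_then_else_)
open import Data.Empty using (⊥-elim)
open import Data.Fin.Base using (Fin; zero; suc)
open import Data.Fin.Induction using (po-noetherian)
open import Data.Fin.Properties using (_≟_; all?; ∀-cons; ¬∀⟶∃¬; suc-injective)
open import Data.List.Base using (List; []; _∷_; _++_; allFin; cartesianProductWith; filter; foldr; map)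
open import Data.List.Properties using (map-tabulate)
open import Data.Nat.Base as ℕ using (ℕ; zero; suc)
open import Data.Product.Base using (∃; _×_; _,_; proj₁; proj₂)
open import Data.Sum.Base using (inj₁; inj₂)
open import Function.Base using (_∘_; flip; id)
open import Function.Bundles using (_⇔_; mk⇔; Equivalence)
open import Function.Construct.Composition using (_⇔-∘_)
open import Induction.WellFounded using (Acc; acc)
open import Level using (0ℓ)
open import Relation.Binary.Core using (Rel)
open import Relation.Binary.PropositionalEquality.Core as ≡ using (_≡_; _≢_; cong)
import Relation.Binary.Reasoning.Setoid as SetoidReasoning
open import Relation.Binary.Structures using (IsDecPartialOrder)
open import Relation.Nullary using (¬_; Dec; yes; no; does)
open import Relation.Nullary.Decidable using (¬?; _→-dec_; _⊎-dec_)
open import Relation.Unary using (Pred; _∈_)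
import Relation.Unary as Unary

-- Iterated operations over lists in a commutative monoid.

module IteratedOperation {c ℓ} (M : CommutativeMonoid c ℓ) where

  open CommutativeMonoid M
  open CommutativeSemigroupProperties commutativeSemigroup using (interchange)
  open SetoidReasoning setoid

  ⨁ : ∀ {a} {A : Set a} → List A → (A → Carrier) → Carrier
  ⨁ xs f = foldr _∙_ ε (map f xs)

  module _ {a} {A : Set a} where

    ⨁-cong : ∀ (xs : List A) {f g : A → Carrier} → (∀ x → f x ≈ g x) → ⨁ xs f ≈ ⨁ xs g
    ⨁-cong []       f≈g = refl
    ⨁-cong (x ∷ xs) f≈g = ∙-cong (f≈g x) (⨁-cong xs f≈g)

    ⨁-ε : ∀ (xs : List A) → ⨁ xs (λ _ → ε) ≈ ε
    ⨁-ε []       = refl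
    ⨁-ε (x ∷ xs) = trans (identityˡ _) (⨁-ε xs)

    ⨁-∙ : ∀ (xs : List A) (f g : A → Carrier) → ⨁ xs (λ x → f x ∙ g x) ≈ ⨁ xs f ∙ ⨁ xs g
    ⨁-∙ []       f g = sym (identityˡ ε)
    ⨁-∙ (x ∷ xs) f g = trans (∙-congˡ (⨁-∙ xs f g)) (interchange _ _ _ _)

    ⨁-++ : ∀ (xs ys : List A) (f : A → Carrier) → ⨁ (xs ++ ys) f ≈ ⨁ xs f ∙ ⨁ ys f
    ⨁-++ []       ys f = sym (identityˡ _)
    ⨁-++ (x ∷ xs) ys f = trans (∙-congˡ (⨁-++ xs ys f)) (sym (assoc _ _ _))

    -- A rejected entry contributes the neutral element instead of disappearing. Operations over
    -- different sublists thereby run over one common list and can be merged or interchanged; the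
    -- default becomes `0#` for sums and `1#` for products.
    ⨁-filter : ∀ {p} {P : Pred A p} (P? : Unary.Decidable P) xs (f : A → Carrier) →
               ⨁ (filter P? xs) f ≈ ⨁ xs (λ x → if does (P? x) then f x else ε)
    ⨁-filter P? []       f = refl
    ⨁-filter P? (x ∷ xs) f with P? x
    ... | yes _ = ∙-congˡ (⨁-filter P? xs f)
    ... | no  _ = trans (⨁-filter P? xs f) (sym (identityˡ _))

  ⨁-map : ∀ {a b} {A : Set a} {B : Set b} (g : A → B) xs (f : B → Carrier) →
          ⨁ (map g xs) f ≈ ⨁ xs (f ∘ g)
  ⨁-map g []       f = refl
  ⨁-map g (x ∷ xs) f = ∙-congˡ (⨁-map g xs f)

  ⨁-comm : ∀ {a b} {A : Set a} {B : Set b} xs ys (f : A → B → Carrier) →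
           ⨁ xs (λ x → ⨁ ys (f x)) ≈ ⨁ ys (λ y → ⨁ xs (λ x → f x y))
  ⨁-comm []       ys f = sym (⨁-ε ys)
  ⨁-comm (x ∷ xs) ys f = trans (∙-congˡ (⨁-comm xs ys f)) (sym (⨁-∙ ys (f x) _))

  ⨁-cartesianProductWith :
    ∀ {a b d} {A : Set a} {B : Set b} {D : Set d} (g : A → B → D) xs ys (f : D → Carrier) →
    ⨁ (cartesianProductWith g xs ys) f ≈ ⨁ xs (λ x → ⨁ ys (λ y → f (g x y)))
  ⨁-cartesianProductWith g []       ys f = refl
  ⨁-cartesianProductWith g (x ∷ xs) ys f = trans (⨁-++ (map (g x) ys) _ f)
    (∙-cong (⨁-map (g x) ys f) (⨁-cartesianProductWith g xs ys f))

  ⨁-allFin-suc : ∀ {n} (f : Fin (suc n) → Carrier) →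
                 ⨁ (allFin (suc n)) f ≈ f zero ∙ ⨁ (allFin n) (f ∘ suc)
  -- The tail of `allFin (suc n)` is `tabulate suc`; mapping `f` over it and mapping `f ∘ suc` over
  -- `allFin n` both fuse to `tabulate (f ∘ suc)`.
  ⨁-allFin-suc f = ∙-congˡ (reflexive (cong (foldr _∙_ ε)
    (≡.trans (map-tabulate suc f) (≡.sym (map-tabulate id (f ∘ suc))))))

  ⨁-allFin-single : ∀ {n} (v : Fin n) (f : Fin n → Carrier) →
                    (∀ u → u ≢ v → f u ≈ ε) → ⨁ (allFin n) f ≈ f v
  ⨁-allFin-single {suc n} zero f f≈ε = begin
    ⨁ (allFin (suc n)) f            ≈⟨ ⨁-allFin-suc f ⟩
    f zero ∙ ⨁ (allFin n) (f ∘ suc) ≈⟨ ∙-congˡ (⨁-cong (allFin n) λ u → f≈ε (suc u) λ ()) ⟩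
    f zero ∙ ⨁ (allFin n) (λ _ → ε) ≈⟨ ∙-congˡ (⨁-ε (allFin n)) ⟩
    f zero ∙ ε                      ≈⟨ identityʳ _ ⟩
    f zero                          ∎
  ⨁-allFin-single {suc n} (suc v) f f≈ε = begin
    ⨁ (allFin (suc n)) f            ≈⟨ ⨁-allFin-suc f ⟩
    f zero ∙ ⨁ (allFin n) (f ∘ suc) ≈⟨ ∙-congʳ (f≈ε zero λ ()) ⟩
    ε ∙ ⨁ (allFin n) (f ∘ suc)      ≈⟨ identityˡ _ ⟩
    ⨁ (allFin n) (f ∘ suc)          ≈⟨ ⨁-allFin-single v (f ∘ suc) (λ u u≢v → f≈ε (suc u) (u≢v ∘ suc-injective)) ⟩
    f (suc v)                       ∎

-- Distributivity: sums of coordinatewise products over boxes.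

module SumsOfProducts {c ℓ} (R : CommutativeSemiring c ℓ) where

  open CommutativeSemiring R hiding (zero)
  open SetoidReasoning setoid
  open IteratedOperation +-commutativeMonoid public
    renaming ( ⨁ to ∑; ⨁-cong to ∑-cong; ⨁-filter to ∑-filter; ⨁-comm to ∑-comm
             ; ⨁-cartesianProductWith to ∑-cartesianProductWith
             ; ⨁-allFin-single to ∑-allFin-single )
    using ()
  open IteratedOperation *-commutativeMonoid public
    renaming ( ⨁ to ∏; ⨁-cong to ∏-cong; ⨁-∙ to ∏-*; ⨁-filter to ∏-filter
             ; ⨁-allFin-suc to ∏-allFin-suc; ⨁-allFin-single to ∏-allFin-single )
    using ()

  module _ {a} {A : Set a} where

    ∑-*ˡ : ∀ k (xs : List A) (f : A → Carrier) → ∑ xs (λ x → k * f x) ≈ k * ∑ xs f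
    ∑-*ˡ k []       f = sym (zeroʳ k)
    ∑-*ˡ k (x ∷ xs) f = trans (+-congˡ (∑-*ˡ k xs f)) (sym (distribˡ k _ _))

    ∑-*ʳ : ∀ k (xs : List A) (f : A → Carrier) → ∑ xs (λ x → f x * k) ≈ ∑ xs f * k
    ∑-*ʳ k xs f = begin
      ∑ xs (λ x → f x * k) ≈⟨ ∑-cong xs (λ x → *-comm (f x) k) ⟩
      ∑ xs (λ x → k * f x) ≈⟨ ∑-*ˡ k xs f ⟩
      k * ∑ xs f           ≈⟨ *-comm k _ ⟩
      ∑ xs f * k           ∎

  ∏-zero : ∀ {n} (j : Fin n) (f : Fin n → Carrier) → f j ≈ 0# → ∏ (allFin n) f ≈ 0#
  ∏-zero zero    f fj≈0 = begin
    _                ≈⟨ ∏-allFin-suc f ⟩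
    f zero * _       ≈⟨ *-congʳ fj≈0 ⟩
    0# * _           ≈⟨ zeroˡ _ ⟩
    0#               ∎
  ∏-zero (suc j) f fj≈0 = begin
    _                ≈⟨ ∏-allFin-suc f ⟩
    f zero * _       ≈⟨ *-congˡ (∏-zero j (f ∘ suc) fj≈0) ⟩
    f zero * 0#      ≈⟨ zeroʳ _ ⟩
    0#               ∎

  -- Induction on the number of coordinates: `points` is a Cartesian product of the first coordinate
  -- with the remaining ones, so the first factor leaves the inner sum and the inner sum then leaves
  -- the outer one.
  ∑-points-∏ : ∀ {n} (size : Fin n → ℕ) (h : ∀ j → Fin (size j) → Carrier) →
               ∑ (points size) (λ y → ∏ (allFin n) (λ j → h j (y j)))
               ≈ ∏ (allFin n) (λ j → ∑ (allFin (size j)) (h j))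
  ∑-points-∏ {zero}  size h = +-identityʳ 1#
  ∑-points-∏ {suc n} size h = begin
    ∑ (points size) whole
      ≈⟨ ∑-cartesianProductWith (∀-cons {P = Fin ∘ size}) (allFin (size zero)) (points (size ∘ suc)) whole ⟩
    ∑ (allFin (size zero)) (λ u → ∑ (points (size ∘ suc)) (λ y →
      whole (∀-cons u y)))
      ≈⟨ ∑-cong (allFin (size zero)) (λ u → trans
           (∑-cong (points (size ∘ suc)) (λ y → ∏-allFin-suc (λ j → h j (∀-cons {P = Fin ∘ size} u y j))))
           (∑-*ˡ (h zero u) (points (size ∘ suc)) tail)) ⟩
    ∑ (allFin (size zero)) (λ u → h zero u * ∑ (points (size ∘ suc)) tail)
      ≈⟨ ∑-*ʳ _ (allFin (size zero)) (h zero) ⟩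
    ∑ (allFin (size zero)) (h zero) * ∑ (points (size ∘ suc)) tail
      ≈⟨ *-congˡ (∑-points-∏ (size ∘ suc) (λ j → h (suc j))) ⟩
    ∑ (allFin (size zero)) (h zero) * ∏ (allFin n) (λ j → ∑ (allFin (size (suc j))) (h (suc j)))
      ≈⟨ ∏-allFin-suc (λ j → ∑ (allFin (size j)) (h j)) ⟨
    ∏ (allFin (suc n)) (λ j → ∑ (allFin (size j)) (h j)) ∎
    where
    whole : Point size → Carrier
    whole y = ∏ (allFin (suc n)) (λ j → h j (y j))
    tail : Point (size ∘ suc) → Carrier
    tail y = ∏ (allFin n) (λ j → h (suc j) (y j))

  -- The indicator of a conjunction is the product of the indicators. When the conjunction fails,
  -- decidability over a finite index set supplies a failing coordinate, and its zero factor kills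
  -- the product.
  ∏-if : ∀ {n} {q p} {Q : Set q} {P : Pred (Fin n) p} (Q? : Dec Q) (P? : Unary.Decidable P) →
         Q ⇔ (∀ j → P j) → (f : Fin n → Carrier) →
         (if does Q? then ∏ (allFin n) f else 0#)
         ≈ ∏ (allFin n) (λ j → if does (P? j) then f j else 0#)
  ∏-if {n} {P = P} (yes q) P? Q⇔∀P f = ∏-cong (allFin n) holds
    where
    holds : ∀ j → f j ≈ (if does (P? j) then f j else 0#)
    holds j with P? j
    ... | yes _  = refl
    ... | no ¬pj = ⊥-elim (¬pj (Equivalence.to Q⇔∀P q j))
  ∏-if {n} {P = P} (no ¬q) P? Q⇔∀P f = sym (∏-zero (proj₁ fails) _ (vanishes (proj₂ fails)))
    where
    fails : ∃ λ j → ¬ P j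
    fails = ¬∀⟶∃¬ n P P? (¬q ∘ Equivalence.from Q⇔∀P)
    vanishes : ∀ {j} → ¬ P j → (if does (P? j) then f j else 0#) ≈ 0#
    vanishes {j} ¬pj with P? j
    ... | yes pj = ⊥-elim (¬pj pj)
    ... | no _   = refl

  -- The condition defining the box is absorbed into the factors as coordinatewise indicators, which
  -- reduces the claim to the sum over all points.
  ∑-box-∏ : ∀ {n p q} (size : Fin n → ℕ) {P : ∀ j → Pred (Fin (size j)) p} {Q : Pred (Point size) q}
            (P? : ∀ j → Unary.Decidable (P j)) (Q? : Unary.Decidable Q) →
            (∀ y → Q y ⇔ (∀ j → P j (y j))) → (h : ∀ j → Fin (size j) → Carrier) →
            ∑ (filter Q? (points size)) (λ y → ∏ (allFin n) (λ j → h j (y j)))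
            ≈ ∏ (allFin n) (λ j → ∑ (filter (P? j) (allFin (size j))) (h j))
  ∑-box-∏ {n} size P? Q? Q⇔∀P h = begin
    _ ≈⟨ ∑-filter Q? (points size) _ ⟩
    ∑ (points size) (λ y → if does (Q? y) then ∏ (allFin n) (λ j → h j (y j)) else 0#)
      ≈⟨ ∑-cong (points size) (λ y → ∏-if (Q? y) (λ j → P? j (y j)) (Q⇔∀P y) _) ⟩
    ∑ (points size) (λ y → ∏ (allFin n) (λ j → if does (P? j (y j)) then h j (y j) else 0#))
      ≈⟨ ∑-points-∏ size (λ j u → if does (P? j u) then h j u else 0#) ⟩
    ∏ (allFin n) (λ j → ∑ (allFin (size j)) (λ u → if does (P? j u) then h j u else 0#))
      ≈⟨ ∏-cong (allFin n) (λ j → ∑-filter (P? j) (allFin (size j)) (h j)) ⟨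
    _ ∎

  -- Since the cases exclude each other, exactly one of the three factors on the right differs from
  -- the default `1#`. This is what merges the three partial products in a summand of the crested
  -- product into one product over all coordinates.
  split-cases : ∀ {p q} {P : Set p} {Q : Set q} (P? : Dec P) (Q? : Dec Q) → ¬ (P × Q) →
                ∀ a b d →
                (if does P? then a else if does Q? then b else d)
                ≈ (if does Q? then b else 1#) * (if does P? then a else 1#)
                  * (if does (¬? (P? ⊎-dec Q?)) then d else 1#)
  split-cases (yes p) (yes q) ¬pq a b d = ⊥-elim (¬pq (p , q))
  split-cases (yes p) (no _)  ¬pq a b d = sym (trans (*-identityʳ _) (*-identityˡ a))
  split-cases (no _)  (yes _) ¬pq a b d = sym (trans (*-identityʳ _) (*-identityʳ b))
  split-cases (no _)  (no _)  ¬pq a b d = sym (trans (*-congʳ (*-identityʳ 1#)) (*-identityˡ d))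

-- The identity chain.

module IdentityChain {c ℓ₁ ℓ₂} (𝔽 : OrderedField c ℓ₁ ℓ₂) where

  open OrderedField 𝔽
  open SumsOfProducts (CommutativeRing.commutativeSemiring commutativeRing)
    using (∑-filter; ∑-allFin-single)

  δ-≢ : ∀ {m} {u v : Fin m} → v ≢ u → δ u v ≈ 0#
  δ-≢ {u = u} {v} v≢u with u ≟ v
  ... | yes u≡v = ⊥-elim (v≢u (≡.sym u≡v))
  ... | no  _   = refl

  δ-refl : ∀ {m} (u : Fin m) → δ u u ≈ 1#
  δ-refl u with u ≟ u
  ... | yes _  = refl
  ... | no u≢u = ⊥-elim (u≢u ≡.refl)

  module _ {m p} {P : Pred (Fin m) p} (P? : Unary.Decidable P) where

    ∑-δ : ∀ u → ∑ (filter P? (allFin m)) (δ u) ≈ (if does (P? u) then δ u u else 0#)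
    ∑-δ u = trans (∑-filter P? (allFin m) (δ u)) (∑-allFin-single u _ off-diagonal)
      where
      off-diagonal : ∀ v → v ≢ u → (if does (P? v) then δ u v else 0#) ≈ 0#
      off-diagonal v v≢u with P? v
      ... | yes _ = δ-≢ v≢u
      ... | no  _ = refl

    -- Together with `∑-δ-∉`: the identity chain enters a set with probability 1 or 0 according to
    -- whether it starts there, which makes it lumpable for every partition.
    ∑-δ-∈ : ∀ {u} → P u → ∑ (filter P? (allFin m)) (δ u) ≈ 1#
    ∑-δ-∈ {u} pu with P? u | ∑-δ u
    ... | yes _  | eq = trans eq (δ-refl u)
    ... | no ¬pu | _  = ⊥-elim (¬pu pu)

    ∑-δ-∉ : ∀ {u} → ¬ P u → ∑ (filter P? (allFin m)) (δ u) ≈ 0#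
    ∑-δ-∉ {u} ¬pu with P? u | ∑-δ u
    ... | yes pu | _  = ⊥-elim (¬pu pu)
    ... | no _   | eq = eq

module GeneralizedLumping
  {c ℓ₁ ℓ₂} (𝔽 : OrderedField c ℓ₁ ℓ₂)
  {n : ℕ} {_⪯_ : Rel (Fin n) 0ℓ} (isPoset : IsDecPartialOrder _≡_ _⪯_)
  (size : Fin n → ℕ) (2≤size : ∀ i → 2 ℕ.≤ size i)
  (P : ∀ i → Chains.MarkovChain 𝔽 (size i))
  (p⁰ : Chains.StrictProbability 𝔽 n)
  (Φ : ∀ i → X⟨_⟩ size (FinitePoset.A isPoset i) → Chains.𝕃 𝔽 (P i))
  (compatible : CrestedProduct.Lumpings.Compatible 𝔽 isPoset size 2≤size P Φ)
  where

  open OrderedField 𝔽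
  open Chains 𝔽
  open CrestedProduct 𝔽 isPoset size 2≤size P
  open Lumpings Φ
  open SumsOfProducts (CommutativeRing.commutativeSemiring commutativeRing) hiding (∑; ∏)
  open IdentityChain 𝔽
  open SetoidReasoning setoid
  private
    module Poset = IsDecPartialOrder isPoset
    module 𝓛 = Partition productOfLumpings

  -- Classes of the product of lumpings as boxes.

  Agree-trans : ∀ {i x y z} → Agree i x y → Agree i y z → Agree i x z
  Agree-trans {i} {x} {y} {z} (eq , r) (eq′ , r′) =
    (λ u v → eq′ u v ⇔-∘ eq u v) ,
    Partition.trans (Φ⟨ i ⟩ x) r (Equivalence.from (eq (y i) (z i)) r′)

  -- z is fixed on the left, so the partitions Φ_j(z) do not depend on the tested point.
  Inside : Point size → Fin n → Pred (Point size) 0ℓ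
  Inside z j y = y j ∈ part (Φ⟨ j ⟩ z) (z j)

  Inside? : ∀ z j → Unary.Decidable (Inside z j)
  Inside? z j y = part? (Φ⟨ j ⟩ z) (z j) (y j)

  -- Induction downwards from the maximal elements. All indices above `j` stay in the up-closed set
  -- `U`, so agreement is known on `A j`, and compatibility identifies the two partitions at `j`.
  -- The set `U` is a parameter because two instances occur: all indices, and the complement of
  -- `H[ i ]`.
  inside⇒agree : ∀ {ℓ} {U : Pred (Fin n) ℓ} → (∀ {j k} → j ∈ U → j ≺ k → k ∈ U) →
                 ∀ {z y} → (∀ j → j ∈ U → Inside z j y) → ∀ j → j ∈ U → Agree j z y
  inside⇒agree {U = U} upClosed {z} {y} inside j = go (po-noetherian Poset.isPartialOrder j)
    where
    go : ∀ {j} → Acc (flip _≺_) j → j ∈ U → Agree j z y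
    go {j} (acc above) j∈U =
      compatible j z y (λ k j≺k → go (above j≺k) (upClosed j∈U j≺k)) , inside j j∈U

  class⇔box : ∀ z y → y ∈ part productOfLumpings z ⇔ (∀ j → Inside z j y)
  class⇔box z y = mk⇔ (λ z≈y j → proj₂ (z≈y j))
    (λ inside j → inside⇒agree {U = Unary.U} (λ _ _ → _) (λ k _ → inside k) j _)

  -- Factorization of the transition probabilities.

  -- The decisions are arguments because H? i j unfolds, so `with` cannot abstract over it.
  factor′ : ∀ {B C : Set} → Dec B → Dec C → ∀ j → Kernel (Fin (size j))
  factor′ below? at? j u v =
    if does below? then 1/∣X∣ j else if does at? then kernel (P j) u v else δ u v

  factor : Fin n → ∀ j → Kernel (Fin (size j))
  factor i j = factor′ (H? i j) (j ≟ i) j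

  summand≈∏factor : ∀ i (x y : Point size) →
      weight p⁰ i * kernel (P i) (x i) (y i)
      * ∏ (filter (H? i) (allFin n)) 1/∣X∣
      * ∏ (filter (¬? ∘ H[ i ]?) (allFin n)) (λ j → δ (x j) (y j))
    ≈ weight p⁰ i * ∏ (allFin n) (λ j → factor i j (x j) (y j))
  summand≈∏factor i x y = begin
    weight p⁰ i * kernel (P i) (x i) (y i)
      * ∏ (filter (H? i) (allFin n)) 1/∣X∣
      * ∏ (filter (¬? ∘ H[ i ]?) (allFin n)) (λ j → δ (x j) (y j))
      ≈⟨ *-cong (*-congˡ (∏-filter (H? i) (allFin n) 1/∣X∣))
                (∏-filter (¬? ∘ H[ i ]?) (allFin n) (λ j → δ (x j) (y j))) ⟩
    weight p⁰ i * kernel (P i) (x i) (y i) * ∏ (allFin n) below * ∏ (allFin n) outside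
      ≈⟨ *-congʳ (*-congʳ (*-congˡ kernel≈∏at)) ⟩
    weight p⁰ i * ∏ (allFin n) at * ∏ (allFin n) below * ∏ (allFin n) outside
      ≈⟨ trans (*-congʳ (*-assoc _ _ _)) (*-assoc _ _ _) ⟩
    weight p⁰ i * (∏ (allFin n) at * ∏ (allFin n) below * ∏ (allFin n) outside)
      ≈⟨ *-congˡ (*-congʳ (∏-* (allFin n) at below)) ⟨
    weight p⁰ i * (∏ (allFin n) (λ j → at j * below j) * ∏ (allFin n) outside)
      ≈⟨ *-congˡ (∏-* (allFin n) (λ j → at j * below j) outside) ⟨
    weight p⁰ i * ∏ (allFin n) (λ j → at j * below j * outside j)
      ≈⟨ *-congˡ (∏-cong (allFin n) (λ j →
           split-cases (H? i j) (j ≟ i) (λ ((_ , j≢i) , j≡i) → j≢i j≡i) _ _ _)) ⟨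
    weight p⁰ i * ∏ (allFin n) (λ j → factor i j (x j) (y j)) ∎
    where
    at below outside : Fin n → Carrier
    -- The chain is `P j` rather than `P i`, so that the expression is typed at every `j`; off `i`
    -- the default `1#` makes the whole product collapse to the single kernel entry at `i`.
    at j      = if does (j ≟ i) then kernel (P j) (x j) (y j) else 1#
    below j   = if does (H? i j) then 1/∣X∣ j else 1#
    outside j = if does (¬? (H[ i ]? j)) then δ (x j) (y j) else 1#

    off-i : ∀ j → j ≢ i → at j ≈ 1#
    off-i j j≢i with j ≟ i
    ... | yes j≡i = ⊥-elim (j≢i j≡i)
    ... | no  _   = refl

    at-i : at i ≈ kernel (P i) (x i) (y i)
    at-i with i ≟ i
    ... | yes _  = refl
    ... | no i≢i = ⊥-elim (i≢i ≡.refl)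

    kernel≈∏at : kernel (P i) (x i) (y i) ≈ ∏ (allFin n) at
    kernel≈∏at = sym (trans (∏-allFin-single i at off-i) at-i)

  -- The partition is the one chosen at the target `z`, independent of the starting point; comparing
  -- it with the partition chosen at the start is the task of the lemmas below.
  factorMass : Point size → Fin n → ∀ j → Fin (size j) → Carrier
  factorMass z i j u = ∑ (filter (part? (Φ⟨ j ⟩ z) (z j)) (allFin (size j))) (factor i j u)

  classMass : ∀ z x → ∑ (filter (part? productOfLumpings z) (points size)) (crestedProduct p⁰ x)
                    ≈ ∑ (allFin n) (λ i → weight p⁰ i * ∏ (allFin n) (λ j → factorMass z i j (x j)))
  classMass z x = begin
    ∑ class (crestedProduct p⁰ x)
      ≈⟨ ∑-cong class (λ y → ∑-cong (allFin n) (λ i → summand≈∏factor i x y)) ⟩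
    ∑ class (λ y → ∑ (allFin n) (λ i → weight p⁰ i * ∏ (allFin n) (λ j → factor i j (x j) (y j))))
      ≈⟨ ∑-comm class (allFin n) _ ⟩
    ∑ (allFin n) (λ i → ∑ class (λ y → weight p⁰ i * ∏ (allFin n) (λ j → factor i j (x j) (y j))))
      ≈⟨ ∑-cong (allFin n) (λ i → trans (∑-*ˡ (weight p⁰ i) class _) (*-congˡ
           (∑-box-∏ size (λ j → part? (Φ⟨ j ⟩ z) (z j)) (part? productOfLumpings z)
             (class⇔box z) (λ j → factor i j (x j))))) ⟩
    ∑ (allFin n) (λ i → weight p⁰ i * ∏ (allFin n) (λ j → factorMass z i j (x j))) ∎
    where
    class : List (Point size)
    class = filter (part? productOfLumpings z) (points size)

  -- Comparison of two starting points in one class.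

  -- The `i`-th summand never moves coordinates outside `H[ i ]`, so it reaches the class of `z`
  -- only from points satisfying this condition.
  InsideOff : Point size → Fin n → Pred (Point size) 0ℓ
  InsideOff z i y = ∀ j → ¬ (j ∈ H[ i ]) → Inside z j y

  -- `H[ i ]` is a down-set; antisymmetry rules out `j ≡ i` when `j ≺ k ≺ i`.
  ∁H[]-upClosed : ∀ {i j k} → ¬ (j ∈ H[ i ]) → j ≺ k → ¬ (k ∈ H[ i ])
  ∁H[]-upClosed j∉ j≺k (inj₂ ≡.refl) = j∉ (inj₁ j≺k)
  ∁H[]-upClosed {i} {j} {k} j∉ (j⪯k , j≢k) (inj₁ (k⪯i , k≢i)) =
    j∉ (inj₁ (Poset.trans j⪯k k⪯i , λ { ≡.refl → j≢k (Poset.antisym j⪯k k⪯i) }))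

  A⊆∁H[] : ∀ {i j} → i ≺ j → ¬ (j ∈ H[ i ])
  A⊆∁H[] (i⪯j , i≢j) (inj₁ (j⪯i , _)) = i≢j (Poset.antisym i⪯j j⪯i)
  A⊆∁H[] (i⪯j , i≢j) (inj₂ j≡i)       = i≢j (≡.sym j≡i)

  insideOff⇒agree : ∀ {z i x} → InsideOff z i x → ∀ j → ¬ (j ∈ H[ i ]) → Agree j z x
  insideOff⇒agree {i = i} = inside⇒agree {U = λ j → ¬ (j ∈ H[ i ])} ∁H[]-upClosed

  -- The relation between `x j` and `x′ j` refers to the partition chosen at `x`, whereas the claim
  -- refers to the one at `z`. Full agreement of `z` with `x` outside `H[ i ]` bridges the two.
  insideOff-resp : ∀ {z i x x′} → x ~[ productOfLumpings ] x′ → InsideOff z i x → InsideOff z i x′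
  insideOff-resp x≈x′ inside j j∉ = proj₂ (Agree-trans (insideOff⇒agree inside j j∉) (x≈x′ j))

  factorMass-cong : ∀ {z i x x′} → x ~[ productOfLumpings ] x′ → InsideOff z i x →
                    ∀ j → factorMass z i j (x j) ≈ factorMass z i j (x′ j)
  factorMass-cong {z} {i} {x} {x′} x≈x′ inside j = go (H? i j) (j ≟ i)
    where
    part-z? : ∀ j → Unary.Decidable (part (Φ⟨ j ⟩ z) (z j))
    part-z? j = part? (Φ⟨ j ⟩ z) (z j)

    Φz≋Φx : Φ⟨ i ⟩ z ≋ Φ⟨ i ⟩ x
    Φz≋Φx = compatible i z x (λ k i≺k → insideOff⇒agree inside k (A⊆∁H[] i≺k))

    go : (below? : Dec (j ∈ H i)) (at? : Dec (j ≡ i)) →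
         ∑ (filter (part-z? j) (allFin (size j))) (factor′ below? at? j (x j))
         ≈ ∑ (filter (part-z? j) (allFin (size j))) (factor′ below? at? j (x′ j))
    -- The entry `1/∣X∣ j` does not involve the starting coordinate, so both sums are the same term.
    go (yes _)  _            = refl
    -- Lumpability of `P i` for the partition chosen at `z`: the source part is that of `x i`, the
    -- target part that of `z i`. The two may differ, as `InsideOff` does not constrain coordinate
    -- `i`.
    go (no _)   (yes ≡.refl) = proj₂ (Φ i (restrict (A i) z)) (x i) (z i) (x i) (x′ i)
      (Partition.refl (Φ⟨ i ⟩ z)) (Equivalence.from (Φz≋Φx (x i) (x′ i)) (proj₂ (x≈x′ i)))
    go (no j⊀i) (no j≢i)     = trans (∑-δ-∈ (part-z? j) (inside j j∉))
                                 (sym (∑-δ-∈ (part-z? j) (insideOff-resp x≈x′ inside j j∉)))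
      where
      j∉ : ¬ (j ∈ H[ i ])
      j∉ (inj₁ j≺i) = j⊀i j≺i
      j∉ (inj₂ j≡i) = j≢i j≡i

  factorMass-vanishes : ∀ {z i x} → ¬ InsideOff z i x →
                        ∏ (allFin n) (λ j → factorMass z i j (x j)) ≈ 0#
  factorMass-vanishes {z} {i} {x} ¬inside = ∏-zero j _ (vanishes (H? i j) (j ≟ i))
    where
    -- A failing implication has a true premise, so this index lies outside `H[ i ]`, where the
    -- factor is a row of the identity chain that misses the part of `z j`.
    witness : ∃ λ j → ¬ (¬ (j ∈ H[ i ]) → Inside z j x)
    witness = ¬∀⟶∃¬ n _ (λ j → ¬? (H[ i ]? j) →-dec Inside? z j x) ¬inside
    j : Fin n
    j = proj₁ witness
    vanishes : (below? : Dec (j ∈ H i)) (at? : Dec (j ≡ i)) →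
               ∑ (filter (part? (Φ⟨ j ⟩ z) (z j)) (allFin (size j))) (factor′ below? at? j (x j)) ≈ 0#
    vanishes (yes j≺i) _         = ⊥-elim (proj₂ witness (λ j∉ → ⊥-elim (j∉ (inj₁ j≺i))))
    vanishes (no _)    (yes j≡i) = ⊥-elim (proj₂ witness (λ j∉ → ⊥-elim (j∉ (inj₂ j≡i))))
    vanishes (no _)    (no _)    = ∑-δ-∉ (part? (Φ⟨ j ⟩ z) (z j)) (λ j∈ → proj₂ witness (λ _ → j∈))

  summandMass-cong : ∀ {z x x′} → x ~[ productOfLumpings ] x′ → ∀ i →
                     ∏ (allFin n) (λ j → factorMass z i j (x j))
                     ≈ ∏ (allFin n) (λ j → factorMass z i j (x′ j))
  summandMass-cong {z} {x} {x′} x≈x′ i with all? (λ j → ¬? (H[ i ]? j) →-dec Inside? z j x)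
  ... | yes inside = ∏-cong (allFin n) (factorMass-cong x≈x′ inside)
  -- Symmetry of the class relation carries the failure of the condition from `x` to `x′`, so both
  -- products vanish.
  ... | no ¬inside = trans (factorMass-vanishes ¬inside)
    (sym (factorMass-vanishes (¬inside ∘ insideOff-resp (𝓛.sym x≈x′))))

  lumpable : Lumpable (points size) (crestedProduct p⁰) productOfLumpings
  lumpable z z′ x x′ z≈x z≈x′ = begin
    ∑ (filter (part? productOfLumpings z′) (points size)) (crestedProduct p⁰ x)
      ≈⟨ classMass z′ x ⟩
    ∑ (allFin n) (λ i → weight p⁰ i * ∏ (allFin n) (λ j → factorMass z′ i j (x j)))
      -- The point `z` only names the source class and is eliminated here, leaving the direct
      -- relation between `x` and `x′`; the target class is that of `z′`.
      ≈⟨ ∑-cong (allFin n) (λ i → *-congˡ (summandMass-cong (𝓛.trans (𝓛.sym z≈x) z≈x′) i)) ⟩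
    ∑ (allFin n) (λ i → weight p⁰ i * ∏ (allFin n) (λ j → factorMass z′ i j (x′ j)))
      ≈⟨ classMass z′ x′ ⟨
    ∑ (filter (part? productOfLumpings z′) (points size)) (crestedProduct p⁰ x′) ∎

theorem7 : ∀ {c ℓ₁ ℓ₂} (𝔽 : OrderedField c ℓ₁ ℓ₂) →
    let open Chains 𝔽 in
    {n : ℕ} {_⪯_ : Rel (Fin n) 0ℓ} (isPoset : IsDecPartialOrder _≡_ _⪯_)
    (size : Fin n → ℕ) (2≤size : ∀ i → 2 ℕ.≤ size i)
    (P : ∀ i → MarkovChain (size i))
    (p⁰ : StrictProbability n) →
    let open CrestedProduct 𝔽 isPoset size 2≤size P in
    (Φ : ∀ i → X⟨_⟩ size (A i) → 𝕃 (P i)) →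
    let open Lumpings Φ in
    Compatible →
    Lumpable (points size) (crestedProduct p⁰) productOfLumpings
theorem7 𝔽 isPoset size 2≤size P p⁰ Φ compatible =
  GeneralizedLumping.lumpable 𝔽 isPoset size 2≤size P p⁰ Φ compatible
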